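{- Let $p<q<r$ be primes, let $a\in\mathbb{N}$, and let $L=\operatorname{lcm}(p-1,q-1,r-1)$. Assume that $qr\equiv 1 \pmod p$. Then the following statements hold. (i) If $\gcd(a,pqr)=1$, then $a^{L}\equiv 1 \pmod{pqr}$. (ii) If $\gcd(a,pqr)=r$, then $a^{L}\equiv rq(1-a\,a_q)+a\,a_q \pmod{pqr}$. (iii) If $\gcd(a,pqr)=q$, then $a^{L}\equiv r(1-qr)\bar\beta+1 \pmod{pqr}$, where $\bar\beta\in\{0,1,\dots,q-1\}$ satisfies $r\bar\beta+1\equiv 0 \pmod q$. (iv) If $\gcd(a,pqr)=p$, then $a^{L}\equiv 1-rq \pmod{pqr}$. (v) $a_1^{L}+a_2^{L}+a_3^{L}\equiv 2 \pmod{pqr}$ for all $a_1,a_2,a_3\in\mathbb{N}$ satisfying $\gcd(a_1,pqr)=p$, $\gcd(a_2,pqr)=q$ and $\gcd(a_3,pqr)=r$.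
   Context: $\mathbb{N}$ denotes the set of positive integers. For a prime $q$ and $m\in\mathbb{N}$ not divisible by $q$, $m_q\in\{1,2,\dots,q-1\}$ denotes the multiplicative inverse of $m$ modulo $q$, i.e. the unique element of $\{1,\dots,q-1\}$ with $m\,m_q\equiv 1 \pmod q$. In (ii), $a_q$ is this inverse of $a$ modulo $q$. In (v), $a_1,a_2,a_3$ are simply indexed positive integers (the subscripts do not denote inverses). Congruences are between integers. -}

module Defs where

open import Data.Nat as ℕ using (ℕ; zero; suc; z≤n; s≤s)
import Data.Nat.Divisibility as ℕ
import Data.Nat.Properties as ℕ
open import Data.Nat.Coprimality using (Coprime; coprime-Bézout; coprime-divisor)
open import Data.Nat.GCD using (module Bézout)
open import Data.Nat.Primality using (Prime; prime⇒irreducible; prime⇒nonZero; prime⇒nonTrivial)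
open import Data.Integer using (ℤ; +_; -_; _+_; _*_; _-_; ∣_∣; _%ℕ_; _/ℕ_)
open import Data.Integer.DivMod using (n%ℕd<d; a≡a%ℕn+[a/ℕn]*n)
open import Data.Integer.Divisibility.Signed using (_∣_; divides; ∣⇒∣ᵤ; ∣ᵤ⇒∣; ∣m∣n⇒∣m-n)
import Data.Integer.Properties as ℤ
open import Data.Integer.Tactic.RingSolver using (solve-∀)
open import Data.Product using (∃; ∃!; _×_; _,_)
open import Data.Sum using (inj₁; inj₂)
open import Relation.Binary.PropositionalEquality using (_≡_; refl; sym; trans; cong; subst)
open import Relation.Nullary using (¬_; contradiction)

infix 4 _≡_[mod_]

_≡_[mod_] : ℤ → ℤ → ℕ → Set
a ≡ b [mod n ] = + n ∣ a - b

IsInverseMod : (q m x : ℕ) → Set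
IsInverseMod q m x = 1 ℕ.≤ x × x ℕ.< q × (+ m * + x ≡ + 1 [mod q ])

-- The residue β with m β + 1 ≡ 0, i.e. minus the inverse of m, reduced modulo q.
IsNegInverseMod : (q m β : ℕ) → Set
IsNegInverseMod q m β = β ℕ.< q × (+ m * + β + + 1 ≡ + 0 [mod q ])

-- For q prime and q ∤ m, each of the two predicates above holds of exactly one
-- number (inverse-∃! and negInverse-∃!), so quantifying universally over the
-- numbers satisfying it amounts to naming that number.

private
  prime⇒coprime : ∀ {q m} → Prime q → ¬ q ℕ.∣ m → Coprime q m
  prime⇒coprime pq q∤m (d∣q , d∣m) with prime⇒irreducible pq d∣q
  ... | inj₁ d≡1  = d≡1
  ... | inj₂ refl = contradiction d∣m q∤m

  ring₁ : ∀ m y → m * (- y) - + 1 ≡ - (+ 1 + y * m)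
  ring₁ = solve-∀

  ring₂ : ∀ z → + 1 + z - + 1 ≡ z
  ring₂ = solve-∀

  ring₃ : ∀ m x y c → (m * x - c) - (m * y - c) ≡ m * (x - y)
  ring₃ = solve-∀

  ring₄ : ∀ m x c t q → m * x - c ≡ m * (x + t * q) - c - m * t * q
  ring₄ = solve-∀

  ring₅ : ∀ m s c w → m * (c * s) - c - w ≡ c * (m * s - + 1) - w
  ring₅ = solve-∀

  ring₆ : ∀ m k c t q → c * (k * q) - m * t * q ≡ (c * k - m * t) * q
  ring₆ = solve-∀

  toℤ : ∀ a b c d → 1 ℕ.+ a ℕ.* b ≡ c ℕ.* d → + 1 + + a * + b ≡ + c * + d
  toℤ a b c d eq = trans (cong (_+_ (+ 1)) (sym (ℤ.pos-* a b)))
    (trans (cong +_ eq) (ℤ.pos-* c d))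

  bézout : ∀ {q m} → Prime q → ¬ q ℕ.∣ m → ∃ λ s → + m * s ≡ + 1 [mod q ]
  bézout {q} {m} pq q∤m with coprime-Bézout (prime⇒coprime pq q∤m)
  ... | Bézout.+- x y eq = - (+ y) , divides (- (+ x))
    (trans
      (ring₁ (+ m) (+ y))
      (trans (cong -_ (toℤ y m x q eq)) (ℤ.neg-distribˡ-* (+ x) (+ q))))
  ... | Bézout.-+ x y eq = + y , divides (+ x)
    (trans
      (cong (_- + 1) (trans (ℤ.*-comm (+ m) (+ y)) (sym (toℤ x q y m eq))))
      (ring₂ (+ x * + q)))

  ∣-∣<⇒≡ : ∀ {q x y} → x ℕ.< q → y ℕ.< q → q ℕ.∣ ∣ + x - + y ∣ → x ≡ y
  ∣-∣<⇒≡ {q} {x} {y} x<q y<q q∣d = ℤ.+-injective (ℤ.i-j≡0⇒i≡j (+ x) (+ y) (ℤ.∣i∣≡0⇒i≡0 (small _ d<q q∣d)))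
    where
    d<q : ∣ + x - + y ∣ ℕ.< q
    d<q = subst (λ z → ∣ z ∣ ℕ.< q) (sym (ℤ.m-n≡m⊖n x y))
      (ℕ.≤-<-trans (ℤ.∣m⊝n∣≤m⊔n x y) (ℕ.⊔-lub x<q y<q))
    small : ∀ d → d ℕ.< q → q ℕ.∣ d → d ≡ 0
    small zero    _   _   = refl
    small (suc d) d<q q∣d = contradiction (ℕ.∣⇒≤ q∣d) (ℕ.<⇒≱ d<q)

  unique : ∀ {q m x y c} → Prime q → ¬ q ℕ.∣ m → x ℕ.< q → y ℕ.< q →
           + m * + x ≡ c [mod q ] → + m * + y ≡ c [mod q ] → x ≡ y
  unique {q} {m} {x} {y} {c} pq q∤m x<q y<q ex ey =
    ∣-∣<⇒≡ x<q y<q (coprime-divisor (prime⇒coprime pq q∤m)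
      (subst (q ℕ.∣_) (trans (cong ∣_∣ eq) (ℤ.abs-* (+ m) (+ x - + y))) (∣⇒∣ᵤ (∣m∣n⇒∣m-n ex ey))))
    where
    eq : (+ m * + x - c) - (+ m * + y - c) ≡ + m * (+ x - + y)
    eq = ring₃ (+ m) (+ x) (+ y) c

  scale : ∀ m s k c x t q → m * s - + 1 ≡ k * q → c * s ≡ x + t * q →
          m * x - c ≡ (c * k - m * t) * q
  scale m s k c x t q e d = trans (ring₄ m x c t q)
    (trans (cong (λ z → m * z - c - m * t * q) (sym d))
    (trans (ring₅ m s c (m * t * q))
    (trans (cong (λ z → c * z - m * t * q) e) (ring₆ m k c t q))))

  exists : ∀ {q m} c → Prime q → ¬ q ℕ.∣ m → ∃ λ x → x ℕ.< q × (+ m * + x ≡ c [mod q ])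
  exists {q} {m} c pq q∤m with bézout pq q∤m
  ... | s , divides k e =
    (c * s) %ℕ q , n%ℕd<d (c * s) q ,
    divides (c * k - + m * ((c * s) /ℕ q))
      (scale (+ m) s k c _ ((c * s) /ℕ q) (+ q) e (a≡a%ℕn+[a/ℕn]*n (c * s) q))
    where instance _ = prime⇒nonZero pq

  1≤inverse : ∀ {q m} x → Prime q → + m * + x ≡ + 1 [mod q ] → 1 ℕ.≤ x
  1≤inverse         (suc x) _  _ = s≤s z≤n
  1≤inverse {q} {m} zero    pq e =
    contradiction (ℕ.∣1⇒≡1 (subst (λ z → q ℕ.∣ ∣ z - + 1 ∣) (ℤ.*-zeroʳ (+ m)) (∣⇒∣ᵤ e)))
      (ℕ.nonTrivial⇒≢1 {{prime⇒nonTrivial pq}})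

  ring₇ : ∀ z → z - - (+ 1) ≡ z + + 1 - + 0
  ring₇ = solve-∀

inverse-∃! : ∀ {q m} → Prime q → ¬ q ℕ.∣ m → ∃! _≡_ (IsInverseMod q m)
inverse-∃! {q} {m} pq q∤m = go (exists (+ 1) pq q∤m)
  where
  go : (∃ λ x → x ℕ.< q × (+ m * + x ≡ + 1 [mod q ])) → ∃! _≡_ (IsInverseMod q m)
  go (x , x<q , ex) = x , (1≤inverse {q} {m} x pq ex , x<q , ex) ,
    λ { {y} (_ , y<q , ey) → unique {q} {m} {x} {y} {+ 1} pq q∤m x<q y<q ex ey }

negInverse-∃! : ∀ {q m} → Prime q → ¬ q ℕ.∣ m → ∃! _≡_ (IsNegInverseMod q m)
negInverse-∃! {q} {m} pq q∤m = go (exists (- (+ 1)) pq q∤m)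
  where
  go : (∃ λ x → x ℕ.< q × (+ m * + x ≡ - (+ 1) [mod q ])) → ∃! _≡_ (IsNegInverseMod q m)
  go (x , x<q , ex) = x , (x<q , subst (+ q ∣_) (ring₇ (+ m * + x)) ex) ,
    λ { {y} (y<q , ey) → unique {q} {m} {x} {y} { - (+ 1)} pq q∤m x<q y<q ex
      (subst (+ q ∣_) (sym (ring₇ (+ m * + y))) ey) }

-- The power a ^ L is 0 modulo each prime factor of p q r dividing a and, by Fermat's
-- little theorem, 1 modulo the others.  The right-hand sides have the same residues
-- (modulo p thanks to q r ≡ 1), so the Chinese remainder theorem gives the congruences.

{-# OPTIONS --safe #-}
module Submission where

open import Defs
open import Algebra.Properties.Semiring.Sum using (sum-init-last)
open import Data.Fin using (zero; suc; toℕ; fromℕ; inject₁)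
open import Data.Fin.Properties using (toℕ<n; toℕ-fromℕ; toℕ-inject₁)
open import Data.Integer using (ℤ; +_; -_; _+_; _-_; _*_; _^_; ∣_∣; +-0-rawMonoid; +-*-rawSemiring)
open import Data.Integer.Divisibility.Signed
  using (_∣_; divides; ∣-refl; ∣⇒∣ᵤ; ∣ᵤ⇒∣; ∣m∣n⇒∣m+n; ∣m∣n⇒∣m-n; ∣m⇒∣m*n; ∣n⇒∣m*n)
open import Data.Integer.Tactic.RingSolver using (solve-∀)
import Data.Integer.Properties as ℤ
open import Data.Nat as ℕ using (ℕ; zero; suc; _∸_; _<_; _≤_; s≤s; s<s; NonZero; _!)
open import Data.Nat.Combinatorics using (_C_; nCk≡n!/k![n-k]!; nCn≡1; k![n∸k]!∣n!)
open import Data.Nat.Coprimality using (Coprime; coprime-divisor)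
open import Data.Nat.Divisibility as ℕᵈ using () renaming (_∣_ to _∣ᵤ_; _∤_ to _∤ᵤ_)
open import Data.Nat.DivMod using (m/n*n≡m)
open import Data.Nat.GCD using (gcd; gcd[m,n]∣m; gcd-greatest)
open import Data.Nat.LCM using (lcm; m∣lcm[m,n]; n∣lcm[m,n]; lcm-least)
open import Data.Nat.Primality
  using (Prime; euclidsLemma; prime⇒irreducible; prime⇒nonZero; prime⇒nonTrivial)
import Data.Nat.Properties as ℕ
open import Data.Product using (_×_; _,_)
open import Data.Sum using (inj₁; inj₂; [_,_]′)
open import Data.Vec.Functional using (Vector)
open import Function using (id; _∘_)
open import Relation.Binary.PropositionalEquality
  using (_≡_; _≢_; refl; sym; trans; cong; cong₂; subst; module ≡-Reasoning)
open import Relation.Nullary using (contradiction)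

open import Algebra.Definitions.RawMonoid +-0-rawMonoid using (sum) renaming (_×_ to _×ᶻ_)
open import Algebra.Definitions.RawSemiring +-*-rawSemiring using () renaming (_^_ to _^ᴹ_)
import Algebra.Properties.CommutativeSemiring.Binomial ℤ.+-*-commutativeSemiring as Binomial

private
  variable
    k ℓ m n p : ℕ
    x : ℤ

-- Primes, coprimality and divisibility.

prime≢1 : Prime p → p ≢ 1
prime≢1 pp = ℕ.nonTrivial⇒≢1 {{prime⇒nonTrivial pp}}

prime∣prime⇒≡ : Prime p → Prime n → p ∣ᵤ n → p ≡ n
prime∣prime⇒≡ pp pn p∣n = [ (λ p≡1 → contradiction p≡1 (prime≢1 pp)) , id ]′ (prime⇒irreducible pn p∣n)

prime∤⇒coprime : Prime p → p ∤ᵤ n → Coprime p n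
prime∤⇒coprime pp p∤n (d∣p , d∣n) with prime⇒irreducible pp d∣p
... | inj₁ d≡1  = d≡1
... | inj₂ refl = contradiction d∣n p∤n

-- Write `k` as `j * n`: being coprime to `n`, `m` must divide `j`, and multiplying by `n` gives the
-- claim.
coprime-*-∣ : Coprime m n → m ∣ᵤ k → n ∣ᵤ k → m ℕ.* n ∣ᵤ k
coprime-*-∣ {m} {n} c m∣k (ℕᵈ.divides j refl) =
  ℕᵈ.*-monoˡ-∣ n (coprime-divisor c (subst (m ∣ᵤ_) (ℕ.*-comm j n) m∣k))

-- Factorials and binomial coefficients modulo a prime.

prime∤! : Prime p → k < p → p ∤ᵤ k !
prime∤! {k = zero}  pp _   p∣1  = prime≢1 pp (ℕᵈ.∣1⇒≡1 p∣1)
prime∤! {k = suc k} pp k<p p∣k! with euclidsLemma (suc k) (k !) pp p∣k!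
... | inj₁ p∣1+k = ℕᵈ.>⇒∤ k<p p∣1+k
... | inj₂ p∣k!′ = prime∤! pp (ℕ.<-trans (ℕ.n<1+n k) k<p) p∣k!′

n∣n! : ∀ n → .{{NonZero n}} → n ∣ᵤ n !
n∣n! (suc n) = ℕᵈ.m∣m*n (n !)

nCk*k!*[n∸k]!≡n! : k ≤ n → (n C k) ℕ.* (k ! ℕ.* (n ∸ k) !) ≡ n !
nCk*k!*[n∸k]!≡n! {k} {n} k≤n = trans
  (cong (ℕ._* (k ! ℕ.* (n ∸ k) !)) (nCk≡n!/k![n-k]! k≤n))
  (m/n*n≡m (k![n∸k]!∣n! k≤n))
  where instance _ = k ℕ.!* (n ∸ k) !≢0

-- `p` divides `p !`, the product of `p C k` with two factorials of numbers below `p`. It divides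
-- neither factorial, so Euclid's lemma leaves `p C k`.
prime∣pCk : Prime p → 0 < k → k < p → p ∣ᵤ p C k
prime∣pCk {p} {k} pp 0<k k<p
  with euclidsLemma (p C k) (k ! ℕ.* (p ∸ k) !) pp
         (subst (p ∣ᵤ_) (sym (nCk*k!*[n∸k]!≡n! (ℕ.<⇒≤ k<p))) (n∣n! p {{prime⇒nonZero pp}}))
... | inj₁ p∣C = p∣C
... | inj₂ p∣k![p∸k]! with euclidsLemma (k !) ((p ∸ k) !) pp p∣k![p∸k]!
...   | inj₁ p∣k!     = contradiction p∣k! (prime∤! pp k<p)
...   | inj₂ p∣[p∸k]! = contradiction p∣[p∸k]!
        -- `0 < k` enters here: it gives `p ∸ k < p ∸ 0`, that is `p ∸ k < p`.
        (prime∤! pp (ℕ.∸-monoʳ-< {p} {k} {0} 0<k (ℕ.<⇒≤ k<p)))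

-- Fermat's little theorem through the binomial theorem.

×ᶻ≡* : ∀ n z → n ×ᶻ z ≡ + n * z
×ᶻ≡* zero    z = refl
×ᶻ≡* (suc n) z = trans (cong (λ s → z + s) (×ᶻ≡* n z)) (sym (ℤ.suc-* (+ n) z))

-- In the semiring binomial theorem a coefficient acts by repeated addition `×ᶻ`; this carries its
-- divisibility over to the whole term.
∣⇒∣×ᶻ : m ∣ᵤ n → ∀ z → + m ∣ n ×ᶻ z
∣⇒∣×ᶻ {m} {n} m∣n z =
  subst (+ m ∣_) (sym (×ᶻ≡* n z)) (∣m⇒∣m*n {m = + n} z (∣ᵤ⇒∣ m∣n))

^ᴹ≡^ : ∀ x n → x ^ᴹ n ≡ x ^ n
^ᴹ≡^ x zero    = refl
^ᴹ≡^ x (suc n) = cong (x *_) (^ᴹ≡^ x n)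

∣-sum : (t : Vector ℤ n) → (∀ i → x ∣ t i) → x ∣ sum t
∣-sum {zero}  {x} t x∣t = divides (+ 0) refl
∣-sum {suc n} {x} t x∣t = ∣m∣n⇒∣m+n (x∣t zero) (∣-sum (t ∘ suc) (x∣t ∘ suc))

^-mod-1 : ∀ x k → x ≡ + 1 [mod n ] → x ^ k ≡ + 1 [mod n ]
^-mod-1     x zero    x≡1 = divides (+ 0) refl
^-mod-1 {n} x (suc k) x≡1 = subst (+ n ∣_) (lemma x (x ^ k))
  (∣m∣n⇒∣m+n (∣n⇒∣m*n x (^-mod-1 x k x≡1)) x≡1)
  where
  lemma : ∀ x y → x * (y - + 1) + (x - + 1) ≡ x * y - + 1
  lemma = solve-∀

≡0-mod : ∀ x → + n ∣ x → x ≡ + 0 [mod n ]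
≡0-mod {n} x = subst (+ n ∣_) (sym (ℤ.+-identityʳ x))

-- In the binomial expansion the two end terms are `x ^ p` and 1, and every term between them has a
-- coefficient divisible by `p`.
[1+x]^p≡1+x^p : Prime p → ∀ x → (+ 1 + x) ^ p ≡ + 1 + x ^ p [mod p ]
[1+x]^p≡1+x^p {p@(suc m)} pp x = subst (+ p ∣_) (sym diff) (∣-sum middle p∣middle)
  where
  t = Binomial.binomialTerm (+ 1) x p
  -- `t` has `p + 1` terms; `suc (inject₁ i)` runs through the indices from 1 to `p ∸ 1`.
  middle : Vector ℤ m
  middle i = t (suc (inject₁ i))

  p∣middle : ∀ i → + p ∣ middle i
  p∣middle i = ∣⇒∣×ᶻ (prime∣pCk pp (s≤s ℕ.z≤n) j<p) (Binomial.binomial (+ 1) x p (suc (inject₁ i)))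
    where
    j = suc (toℕ (inject₁ i))
    j<p : j < p
    j<p = s<s (subst (_< m) (sym (toℕ-inject₁ i)) (toℕ<n i))

  first : t zero ≡ x ^ p
  first = trans (ℤ.+-identityʳ _) (trans (ℤ.*-identityˡ _) (^ᴹ≡^ x p))

  1^ᴹ : ∀ n → (+ 1) ^ᴹ n ≡ + 1
  1^ᴹ zero    = refl
  1^ᴹ (suc n) = cong (+ 1 *_) (1^ᴹ n)

  last : t (suc (fromℕ m)) ≡ + 1
  -- At index `p` the coefficient is `p C p`, which is 1, and the exponent of `x` is `p ∸ p`, which
  -- is 0.
  last rewrite toℕ-fromℕ m | nCn≡1 p | ℕ.n∸n≡0 m =
    trans (ℤ.+-identityʳ _) (trans (ℤ.*-identityʳ _) (1^ᴹ p))

  lemma : ∀ a s → (a + (s + + 1)) - (+ 1 + a) ≡ s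
  lemma = solve-∀

  open ≡-Reasoning
  diff : (+ 1 + x) ^ p - (+ 1 + x ^ p) ≡ sum middle
  diff = begin
    (+ 1 + x) ^ p - (+ 1 + x ^ p)
      ≡⟨ cong (_- (+ 1 + x ^ p)) (trans (sym (^ᴹ≡^ (+ 1 + x) p)) (Binomial.theorem p (+ 1) x)) ⟩
    (t zero + sum (t ∘ suc)) - (+ 1 + x ^ p)
      ≡⟨ cong (λ s → (t zero + s) - (+ 1 + x ^ p)) (sum-init-last ℤ.+-*-semiring (t ∘ suc)) ⟩
    (t zero + (sum middle + t (suc (fromℕ m)))) - (+ 1 + x ^ p)
      ≡⟨ cong₂ (λ a b → (a + (sum middle + b)) - (+ 1 + x ^ p)) first last ⟩
    (x ^ p + (sum middle + + 1)) - (+ 1 + x ^ p)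
      ≡⟨ lemma (x ^ p) (sum middle) ⟩
    sum middle ∎

-- Induction on `a`: by the previous congruence, passing to `suc a` adds 1 to both sides. Matching
-- `p` as a successor makes the power of zero compute to zero.
a^p≡a : Prime p → ∀ a → (+ a) ^ p ≡ + a [mod p ]
a^p≡a {suc m} pp zero    = divides (+ 0) refl
a^p≡a {p}     pp (suc a) = subst (+ p ∣_) (lemma ((+ suc a) ^ p) ((+ a) ^ p) (+ a))
  (∣m∣n⇒∣m+n ([1+x]^p≡1+x^p pp (+ a)) (a^p≡a pp a))
  where
  lemma : ∀ s b a → (s - (+ 1 + b)) + (b - a) ≡ s - (+ 1 + a)
  lemma = solve-∀

-- `p` divides `a ^ p - a`, which factors as `a * (a ^ (p ∸ 1) - 1)`, and `p` is coprime to `a`.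
a^[p∸1]≡1 : Prime p → ∀ a → p ∤ᵤ a → (+ a) ^ (p ∸ 1) ≡ + 1 [mod p ]
a^[p∸1]≡1 {suc m} pp a p∤a = ∣ᵤ⇒∣ (coprime-divisor (prime∤⇒coprime pp p∤a)
  (subst (suc m ∣ᵤ_) (trans (cong ∣_∣ (lemma (+ a) ((+ a) ^ m))) (ℤ.abs-* (+ a) ((+ a) ^ m - + 1)))
    (∣⇒∣ᵤ (a^p≡a pp a))))
  where
  lemma : ∀ a b → a * b - a ≡ a * (b - + 1)
  lemma = solve-∀

p∤a⇒a^k≡1 : Prime p → ∀ {a} → p ∤ᵤ a → p ∸ 1 ∣ᵤ k → (+ a) ^ k ≡ + 1 [mod p ]
p∤a⇒a^k≡1 {p} pp {a} p∤a (ℕᵈ.divides j refl) =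
  subst (_≡ + 1 [mod p ])
    (trans (ℤ.^-*-assoc (+ a) (p ∸ 1) j) (cong ((+ a) ^_) (ℕ.*-comm (p ∸ 1) j)))
    (^-mod-1 ((+ a) ^ (p ∸ 1)) j (a^[p∸1]≡1 pp a p∤a))

-- A nonzero exponent lets a factor `a` split off, which is why `L` must be shown to be nonzero.
p∣a⇒a^k≡0 : ∀ {a} → p ∣ᵤ a → .{{NonZero k}} → (+ a) ^ k ≡ + 0 [mod p ]
p∣a⇒a^k≡0 {k = suc k} {a} p∣a = ≡0-mod ((+ a) ^ suc k) (∣m⇒∣m*n {m = + a} ((+ a) ^ k) (∣ᵤ⇒∣ p∣a))

-- Nonvanishing of the exponent.

∣-nonZero : m ∣ᵤ n → .{{NonZero n}} → NonZero m
∣-nonZero {zero}  {suc n} 0∣n = contradiction (ℕᵈ.0∣⇒≡0 0∣n) λ ()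
∣-nonZero {suc m}         _   = _

-- The least common multiple divides the nonzero number `m * n`.
lcm-nonZero : ∀ m n → .{{NonZero m}} → .{{NonZero n}} → NonZero (lcm m n)
lcm-nonZero m n = ∣-nonZero (lcm-least {m} {n} (ℕᵈ.m∣m*n n) (ℕᵈ.n∣m*n m)) {{ℕ.m*n≢0 m n}}

prime⇒p∸1≢0 : Prime p → NonZero (p ∸ 1)
prime⇒p∸1≢0 {p} pp = ℕ.>-nonZero (ℕ.m<n⇒0<n∸m (ℕ.nonTrivial⇒n>1 p {{prime⇒nonTrivial pp}}))

-- The Chinese remainder theorem for three distinct primes.

module ThreePrimes
  {p q r : ℕ} (pp : Prime p) (pq : Prime q) (pr : Prime r) (p<q : p < q) (q<r : q < r) where

  L N : ℕ
  L = lcm (lcm (p ∸ 1) (q ∸ 1)) (r ∸ 1)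
  N = p ℕ.* q ℕ.* r

  instance
    L≢0 : NonZero L
    L≢0 = lcm-nonZero (lcm (p ∸ 1) (q ∸ 1)) (r ∸ 1)
      {{lcm-nonZero (p ∸ 1) (q ∸ 1) {{prime⇒p∸1≢0 pp}} {{prime⇒p∸1≢0 pq}}}} {{prime⇒p∸1≢0 pr}}

  ≢⇒∤ : Prime m → Prime n → m ≢ n → m ∤ᵤ n
  ≢⇒∤ pm pn m≢n m∣n = m≢n (prime∣prime⇒≡ pm pn m∣n)

  p≢q : p ≢ q
  p≢q = ℕ.<⇒≢ p<q
  q≢r : q ≢ r
  q≢r = ℕ.<⇒≢ q<r
  p≢r : p ≢ r
  p≢r = ℕ.<⇒≢ (ℕ.<-trans p<q q<r)

  -- Distinct primes are coprime, so `q` and `r` combine first; then `p`, coprime to `q * r`, joins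
  -- them.
  crt : ∀ x → + p ∣ x → + q ∣ x → + r ∣ x → + N ∣ x
  crt x p∣x q∣x r∣x = ∣ᵤ⇒∣ (subst (_∣ᵤ ∣ x ∣) (sym (ℕ.*-assoc p q r))
    (coprime-*-∣ (prime∤⇒coprime pp p∤qr) (∣⇒∣ᵤ p∣x)
      (coprime-*-∣ (prime∤⇒coprime pq (≢⇒∤ pq pr q≢r)) (∣⇒∣ᵤ q∣x) (∣⇒∣ᵤ r∣x))))
    where
    p∤qr : p ∤ᵤ q ℕ.* r
    p∤qr = [ ≢⇒∤ pp pq p≢q , ≢⇒∤ pp pr p≢r ]′ ∘ euclidsLemma q r pp

  -- Used with `x` the power and `y` the claimed value: both are compared with the same simple
  -- residues `i`, `j`, `k`.
  crt-residues : ∀ x y i j k →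
    x ≡ i [mod p ] → x ≡ j [mod q ] → x ≡ k [mod r ] →
    y ≡ i [mod p ] → y ≡ j [mod q ] → y ≡ k [mod r ] → x ≡ y [mod N ]
  crt-residues x y i j k xi xj xk yi yj yk =
    crt (x - y) (via i xi yi) (via j xj yj) (via k xk yk)
    where
    lemma : ∀ x y z → (x - z) - (y - z) ≡ x - y
    lemma = solve-∀
    via : ∀ z → x ≡ z [mod ℓ ] → y ≡ z [mod ℓ ] → x ≡ y [mod ℓ ]
    via {ℓ} z xz yz = subst (+ ℓ ∣_) (lemma x y z) (∣m∣n⇒∣m-n xz yz)

  -- Collects what Fermat's theorem with exponent `L` requires of `ℓ`, so that `p`, `q` and `r` are
  -- treated uniformly.
  data Factor (ℓ : ℕ) : Set where
    factor : Prime ℓ → ℓ ∣ᵤ N → ℓ ∸ 1 ∣ᵤ L → Factor ℓ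

  p-factor : Factor p
  p-factor = factor pp (ℕᵈ.∣m⇒∣m*n r (ℕᵈ.m∣m*n q))
    (ℕᵈ.∣-trans (m∣lcm[m,n] (p ∸ 1) (q ∸ 1)) (m∣lcm[m,n] _ (r ∸ 1)))

  q-factor : Factor q
  q-factor = factor pq (ℕᵈ.∣m⇒∣m*n r (ℕᵈ.n∣m*n p))
    (ℕᵈ.∣-trans (n∣lcm[m,n] (p ∸ 1) (q ∸ 1)) (m∣lcm[m,n] _ (r ∸ 1)))

  r-factor : Factor r
  r-factor = factor pr (ℕᵈ.n∣m*n (p ℕ.* q)) (n∣lcm[m,n] (lcm (p ∸ 1) (q ∸ 1)) (r ∸ 1))

  -- Residues of the power, and the five statements.

  module _ (a : ℕ) where

    A : ℤ
    A = (+ a) ^ L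

    -- If `ℓ` divided `a`, it would be a common divisor of `a` and `N` and hence divide `m`; so
    -- Fermat applies.
    ∤gcd⇒1 : Factor ℓ → gcd a N ≡ m → ℓ ∤ᵤ m → A ≡ + 1 [mod ℓ ]
    ∤gcd⇒1 (factor pℓ ℓ∣N ℓ∸1∣L) refl ℓ∤g =
      p∤a⇒a^k≡1 pℓ (λ ℓ∣a → ℓ∤g (gcd-greatest ℓ∣a ℓ∣N)) ℓ∸1∣L

    gcd≡⇒∣ : gcd a N ≡ m → m ∣ᵤ a
    gcd≡⇒∣ refl = gcd[m,n]∣m a N

    gcd≡⇒0 : gcd a N ≡ m → A ≡ + 0 [mod m ]
    gcd≡⇒0 g = p∣a⇒a^k≡0 (gcd≡⇒∣ g)

    gcd≡1⇒1 : Factor ℓ → gcd a N ≡ 1 → A ≡ + 1 [mod ℓ ]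
    gcd≡1⇒1 f@(factor pℓ _ _) g = ∤gcd⇒1 f g (prime≢1 pℓ ∘ ℕᵈ.∣1⇒≡1)

    gcd≡prime⇒1 : Factor ℓ → Factor m → ℓ ≢ m → gcd a N ≡ m → A ≡ + 1 [mod ℓ ]
    gcd≡prime⇒1 f@(factor pℓ _ _) (factor pm _ _) ℓ≢m g = ∤gcd⇒1 f g (≢⇒∤ pℓ pm ℓ≢m)

    part-i : gcd a N ≡ 1 → A ≡ + 1 [mod N ]
    part-i g = crt (A - + 1) (gcd≡1⇒1 p-factor g) (gcd≡1⇒1 q-factor g) (gcd≡1⇒1 r-factor g)

    -- The residues modulo `p`, `q`, `r` are 1, 1, 0. On the right, with `c = a * b`: modulo `p`,
    -- `r * q` becomes 1 and `c` cancels; modulo `q`, only `c ≡ 1` survives; modulo `r`, both terms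
    -- vanish because `r` divides `a`.
    part-ii : + q * + r ≡ + 1 [mod p ] → gcd a N ≡ r → ∀ b → IsInverseMod q a b →
              A ≡ + r * + q * (+ 1 - + a * + b) + + a * + b [mod N ]
    part-ii qr≡1 g b (_ , _ , ab≡1) = crt-residues A R (+ 1) (+ 1) (+ 0)
      (gcd≡prime⇒1 p-factor r-factor p≢r g)
      (gcd≡prime⇒1 q-factor r-factor q≢r g)
      (gcd≡⇒0 g)
      (subst (+ p ∣_) (sym (mod-p (+ q) (+ r) (+ a * + b))) (∣m⇒∣m*n (+ 1 - + a * + b) qr≡1))
      (subst (+ q ∣_) (sym (mod-q (+ q) (+ r) (+ a * + b)))
        (∣m∣n⇒∣m+n (∣m⇒∣m*n (+ r * (+ 1 - + a * + b)) ∣-refl) ab≡1))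
      (≡0-mod R (∣m∣n⇒∣m+n
        (∣m⇒∣m*n (+ 1 - + a * + b) (∣m⇒∣m*n (+ q) ∣-refl))
        (∣m⇒∣m*n {m = + a} (+ b) (∣ᵤ⇒∣ (gcd≡⇒∣ g)))))
      where
      R = + r * + q * (+ 1 - + a * + b) + + a * + b
      mod-p : ∀ q r c → r * q * (+ 1 - c) + c - + 1 ≡ (q * r - + 1) * (+ 1 - c)
      mod-p = solve-∀
      mod-q : ∀ q r c → r * q * (+ 1 - c) + c - + 1 ≡ q * (r * (+ 1 - c)) + (c - + 1)
      mod-q = solve-∀

    -- The residues are 1, 0, 1. On the right, `1 - q * r` vanishes modulo `p`; modulo `q` what
    -- remains is `r * β + 1`; modulo `r` only the final 1 remains.
    part-iii : + q * + r ≡ + 1 [mod p ] → gcd a N ≡ q → ∀ β → IsNegInverseMod q r β →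
               A ≡ + r * (+ 1 - + q * + r) * + β + + 1 [mod N ]
    part-iii qr≡1 g β (_ , rβ+1≡0) = crt-residues A R (+ 1) (+ 0) (+ 1)
      (gcd≡prime⇒1 p-factor q-factor p≢q g)
      (gcd≡⇒0 g)
      (gcd≡prime⇒1 r-factor q-factor (q≢r ∘ sym) g)
      (subst (+ p ∣_) (sym (mod-p (+ q) (+ r) (+ β))) (∣m⇒∣m*n (- (+ r * + β)) qr≡1))
      (subst (+ q ∣_) (sym (mod-q (+ q) (+ r) (+ β)))
        (∣m∣n⇒∣m-n rβ+1≡0 (∣m⇒∣m*n (+ r * + r * + β) ∣-refl)))
      (subst (+ r ∣_) (sym (mod-r (+ q) (+ r) (+ β))) (∣m⇒∣m*n ((+ 1 - + q * + r) * + β) ∣-refl))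
      where
      R = + r * (+ 1 - + q * + r) * + β + + 1
      mod-p : ∀ q r b → r * (+ 1 - q * r) * b + + 1 - + 1 ≡ (q * r - + 1) * - (r * b)
      mod-p = solve-∀
      mod-q : ∀ q r b → r * (+ 1 - q * r) * b + + 1 - + 0 ≡ (r * b + + 1 - + 0) - q * (r * r * b)
      mod-q = solve-∀
      mod-r : ∀ q r b → r * (+ 1 - q * r) * b + + 1 - + 1 ≡ r * ((+ 1 - q * r) * b)
      mod-r = solve-∀

    -- The residues are 0, 1, 1: `r * q` is 1 modulo `p` and 0 modulo `q` and `r`.
    part-iv : + q * + r ≡ + 1 [mod p ] → gcd a N ≡ p → A ≡ + 1 - + r * + q [mod N ]
    part-iv qr≡1 g = crt-residues A (+ 1 - + r * + q) (+ 0) (+ 1) (+ 1)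
      (gcd≡⇒0 g)
      (gcd≡prime⇒1 q-factor p-factor (p≢q ∘ sym) g)
      (gcd≡prime⇒1 r-factor p-factor (p≢r ∘ sym) g)
      (subst (+ p ∣_) (sym (mod-p (+ q) (+ r))) (∣m⇒∣m*n (- (+ 1)) qr≡1))
      (subst (+ q ∣_) (sym (mod-q (+ q) (+ r))) (∣m⇒∣m*n (- (+ r)) ∣-refl))
      (subst (+ r ∣_) (sym (mod-r (+ q) (+ r))) (∣m⇒∣m*n (- (+ q)) ∣-refl))
      where
      mod-p : ∀ q r → + 1 - r * q - + 0 ≡ (q * r - + 1) * - (+ 1)
      mod-p = solve-∀
      mod-q : ∀ q r → + 1 - r * q - + 1 ≡ q * - r
      mod-q = solve-∀
      mod-r : ∀ q r → + 1 - r * q - + 1 ≡ r * - q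
      mod-r = solve-∀

  -- Modulo each of the three primes exactly one power is 0 and the other two are 1.
  part-v : ∀ a b c → gcd a N ≡ p → gcd b N ≡ q → gcd c N ≡ r →
           (+ a) ^ L + (+ b) ^ L + (+ c) ^ L ≡ + 2 [mod N ]
  part-v a b c ga gb gc = crt (A a + A b + A c - + 2)
    (add 0 1 1
      (gcd≡⇒0 a ga) (gcd≡prime⇒1 b p-factor q-factor p≢q gb) (gcd≡prime⇒1 c p-factor r-factor p≢r gc))
    (add 1 0 1
      (gcd≡prime⇒1 a q-factor p-factor (p≢q ∘ sym) ga) (gcd≡⇒0 b gb) (gcd≡prime⇒1 c q-factor r-factor q≢r gc))
    (add 1 1 0
      (gcd≡prime⇒1 a r-factor p-factor (p≢r ∘ sym) ga)
      (gcd≡prime⇒1 b r-factor q-factor (q≢r ∘ sym) gb)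
      (gcd≡⇒0 c gc))
    where
    lemma : ∀ x y z i j k → (x - i) + (y - j) + (z - k) ≡ (x + y + z) - (i + j + k)
    lemma = solve-∀
    add : ∀ i j k → A a ≡ + i [mod ℓ ] → A b ≡ + j [mod ℓ ] → A c ≡ + k [mod ℓ ] →
          A a + A b + A c ≡ + (i ℕ.+ j ℕ.+ k) [mod ℓ ]
    add {ℓ} i j k ai bj ck = subst (+ ℓ ∣_) (lemma (A a) (A b) (A c) (+ i) (+ j) (+ k))
      (∣m∣n⇒∣m+n (∣m∣n⇒∣m+n ai bj) ck)

theorem5 :
  ∀ (p q r : ℕ) → Prime p → Prime q → Prime r → p < q → q < r →
  ∀ (a : ℕ) → .{{_ : NonZero a}} →
  (+ q * + r ≡ + 1 [mod p ]) →
  let L = lcm (lcm (p ∸ 1) (q ∸ 1)) (r ∸ 1)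
      n = p ℕ.* q ℕ.* r
  in
    (gcd a n ≡ 1 → (+ a) ^ L ≡ + 1 [mod n ])
  × (gcd a n ≡ r → ∀ (aq : ℕ) → IsInverseMod q a aq →
       (+ a) ^ L ≡ + r * + q * (+ 1 - + a * + aq) + + a * + aq [mod n ])
  × (gcd a n ≡ q → ∀ (β : ℕ) → IsNegInverseMod q r β →
       (+ a) ^ L ≡ + r * (+ 1 - + q * + r) * + β + + 1 [mod n ])
  × (gcd a n ≡ p → (+ a) ^ L ≡ + 1 - + r * + q [mod n ])
  × (∀ (a₁ a₂ a₃ : ℕ) → .{{_ : NonZero a₁}} → .{{_ : NonZero a₂}} → .{{_ : NonZero a₃}} →
       gcd a₁ n ≡ p → gcd a₂ n ≡ q → gcd a₃ n ≡ r →
       (+ a₁) ^ L + (+ a₂) ^ L + (+ a₃) ^ L ≡ + 2 [mod n ])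
theorem5 p q r pp pq pr p<q q<r a qr≡1 =
  part-i a , part-ii a qr≡1 , part-iii a qr≡1 , part-iv a qr≡1 , λ a₁ a₂ a₃ → part-v a₁ a₂ a₃
  where open ThreePrimes pp pq pr p<q q<r
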